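{- Let $\alpha=(\alpha_0,\ldots,\alpha_{n-1})\in Q_{n,2^n}$ with $\alpha_0<\cdots<\alpha_{n-1}$, and let $A=\mathbf{P}_{2^n}[\alpha]$ be the induced poset matrix of the binary Pascal matrix. Then the dual matrix $A^*$ is the poset matrix given by $A^*=\mathbf{P}_{2^n}[\beta]$, where $$\beta=(\bar{\alpha}_{n-1},\ldots,\bar{\alpha}_0)\in Q_{n,2^n},\qquad \bar{\alpha}_i=(2^n-1)-\alpha_i,\quad 0\le i\le n-1.$$
   Context: $Q_{n,2^n}$ is the collection of $n$-element subsets of $\{0,1,\ldots,2^n-1\}$, written as vectors. The binary Pascal matrix $\mathbf{P}_{2^n}$ is the $2^n\times2^n$ $(0,1)$-matrix with $(\mathbf{P}_{2^n})_{i,j}\equiv\binom{i}{j}\pmod 2$, $0\le i,j\le 2^n-1$; $\mathbf{P}_{2^n}[\alpha]$ is the $n\times n$ matrix with $(i,j)$ entry $(\mathbf{P}_{2^n})_{\alpha_i,\alpha_j}$. A poset matrix is an $n\times n$ $(0,1)$-matrix $A=[a_{ij}]_{0\le i,j\le n-1}$ that is lower triangular with unit diagonal and transitive ($a_{ij}=1$ and $a_{jk}=1$ imply $a_{ik}=1$). The dual matrix of $A$ is its flip transpose $A^*=E_nA^TE_n$, where $E_n$ is the $n\times n$ anti-diagonal permutation matrix; explicitly $(A^*)_{i,j}=a_{n-1-j,\,n-1-i}$ for $0\le i,j\le n-1$. (It is the poset matrix of the dual poset after relabelling $i\mapsto n-1-i$.) -}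

module Defs where

open import Data.Bool.Base using (if_then_else_)
open import Data.Fin.Base using (Fin; zero; suc; toℕ; opposite; _<_)
open import Data.Fin.Properties using (_≟_; opposite-involutive)
open import Data.Nat.Base using (ℕ; _+_; _*_; _%_)
open import Data.Nat.Combinatorics using (_C_)
open import Data.Nat.Properties using (+-0-monoid; +-identityʳ; *-comm)
open import Algebra.Properties.Monoid.Sum +-0-monoid using (sum-syntax; sum-cong-≗; sum-replicate-zero)
open import Data.Sum.Base using (_⊎_)
open import Data.Vec.Functional using (Vector; map; reverse)
open import Function.Base using (flip)
open import Relation.Binary.Definitions using (Monotonic₁)
open import Relation.Binary.PropositionalEquality
open import Relation.Nullary.Decidable using (does; yes; no; dec-true; dec-false)

private
  variable
    m n : ℕ

Matrix : ℕ → Set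
Matrix n = Vector (Vector ℕ n) n

infix 4 _≋_
_≋_ : Matrix n → Matrix n → Set
A ≋ B = ∀ i j → A i j ≡ B i j

infixl 7 _⊗_
_⊗_ : Matrix n → Matrix n → Matrix n
_⊗_ {n} A B i j = ∑[ k < n ] (A i k * B k j)

infix 9 _ᵀ
_ᵀ : Matrix n → Matrix n
A ᵀ = flip A

-- On Fin n, opposite is i ↦ n - 1 - i.
exchange : ∀ n → Matrix n
exchange n i j = if does (j ≟ opposite i) then 1 else 0

dual : Matrix n → Matrix n
dual {n} A = exchange n ⊗ A ᵀ ⊗ exchange n

record IsPosetMatrix (A : Matrix n) : Set where
  field
    binary          : ∀ i j → A i j ≡ 0 ⊎ A i j ≡ 1
    lowerTriangular : ∀ i j → i < j → A i j ≡ 0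
    unitDiagonal    : ∀ i → A i i ≡ 1
    transitive      : ∀ i j k → A i j ≡ 1 → A j k ≡ 1 → A i k ≡ 1

binaryPascal : ∀ m → Matrix m
binaryPascal m i j = (toℕ i C toℕ j) % 2

infix 9 _⟦_⟧
_⟦_⟧ : Matrix m → Vector (Fin m) n → Matrix n
(A ⟦ α ⟧) i j = A (α i) (α j)

-- An n-element subset of {0, …, m - 1} is written as the vector of its
-- elements in increasing order; IsQ says that α is such a vector.
IsQ : Vector (Fin m) n → Set
IsQ = Monotonic₁ _<_ _<_

-- β i = (m - 1) - α (n - 1 - i): both map opposite (on entries, in Fin m) and
-- reverse (on positions, in Fin n) are needed for β to be increasing again.
reverseComplement : Vector (Fin m) n → Vector (Fin m) n
reverseComplement α = reverse (map opposite α)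

private
  sum-δ : (i : Fin n) (f : Vector ℕ n) →
          ∑[ k < n ] ((if does (k ≟ i) then 1 else 0) * f k) ≡ f i
  sum-δ {ℕ.suc n} zero f =
    trans (cong₂ _+_ (+-identityʳ (f zero)) (sum-replicate-zero n)) (+-identityʳ (f zero))
  sum-δ (suc i) f = sum-δ i (λ k → f (suc k))

  exchange-sym : (i j : Fin n) → exchange n i j ≡ exchange n j i
  exchange-sym i j with j ≟ opposite i
  ... | yes refl rewrite dec-true (i ≟ opposite (opposite i)) (sym (opposite-involutive i)) = refl
  ... | no j≢i′ rewrite dec-false (i ≟ opposite j)
          (λ { refl → j≢i′ (sym (opposite-involutive j)) }) = refl

dual-entry : (A : Matrix n) → dual A ≋ λ i j → A (opposite j) (opposite i)
dual-entry {n} A i j = begin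
  ∑[ k < n ] ((exchange n ⊗ A ᵀ) i k * exchange n k j)
    ≡⟨ sum-cong-≗ (λ k → trans (*-comm ((exchange n ⊗ A ᵀ) i k) _)
                               (cong (_* (exchange n ⊗ A ᵀ) i k) (exchange-sym k j))) ⟩
  ∑[ k < n ] (exchange n j k * (exchange n ⊗ A ᵀ) i k)
    ≡⟨ sum-δ (opposite j) ((exchange n ⊗ A ᵀ) i) ⟩
  ∑[ k < n ] (exchange n i k * A (opposite j) k)
    ≡⟨ sum-δ (opposite i) (A (opposite j)) ⟩
  A (opposite j) (opposite i) ∎
  where open ≡-Reasoning

{-# OPTIONS --safe #-}

-- Everything rests on the reflection C(b', a') ≡ C(a, b) (mod 2), where
-- a + a' = b + b' = M and M = 2^n - 1.  Row M of Pascal's triangle is entirely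
-- odd, which is the case b = 0; Pascal's rule, read modulo 2 as a difference,
-- then carries C(M - b, k) ≡ C(b + k, k) from b to b + 1.  Hence the dual of
-- P[α] is P[β], and it is a poset matrix because β is increasing and P is one,
-- the transitivity of P coming from C(a, b) C(b, c) = C(a, c) C(a - c, b - c).
module Submission where

open import Defs
open import Data.Fin.Base using (Fin; toℕ; opposite)
import Data.Fin.Base as Fin
open import Data.Fin.Properties using (toℕ<n; opposite-prop)
open import Data.Nat.Base
open import Data.Nat.Combinatorics
open import Data.Nat.DivMod using (m/n*n≡m)
open import Data.Nat.Properties
open import Data.Nat.Solver using (module +-*-Solver)
open import Data.Parity.Base using (Parity; 0ℙ; 1ℙ)
import Data.Parity.Base as ℙ
import Data.Parity.Properties as ℙₚ
open import Data.Product.Base using (_×_; _,_)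
open import Data.Sum.Base using (_⊎_; inj₁; inj₂)
open import Data.Vec.Functional using (Vector)
open import Relation.Binary.PropositionalEquality
open import Relation.Nullary.Decidable using (yes; no)

private
  variable
    m n : ℕ

-- Factorial identities for binomial coefficients

nCk*[k!*[n∸k]!]≡n! : ∀ {n k} → k ≤ n → (n C k) * (k ! * (n ∸ k) !) ≡ n !
nCk*[k!*[n∸k]!]≡n! {n} {k} k≤n =
  trans (cong (_* (k ! * (n ∸ k) !)) (nCk≡n!/k![n-k]! k≤n)) (m/n*n≡m (k![n∸k]!∣n! k≤n))
  where instance _ = k !* (n ∸ k) !≢0

-- Multiplied by `c ! * (b ∸ c) ! * (a ∸ b) !`, both sides become `a !`.
trinomial-revision : ∀ {a b c} → c ≤ b → b ≤ a →
                     (a C b) * (b C c) ≡ (a C c) * ((a ∸ c) C (b ∸ c))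
trinomial-revision {a} {b} {c} c≤b b≤a =
  *-cancelʳ-≡ _ _ (c ! * (b ∸ c) ! * (a ∸ b) !) (begin
    (a C b) * (b C c) * (c ! * (b ∸ c) ! * (a ∸ b) !)
      ≡⟨ solve 5 (λ x y p q r → x :* y :* (p :* q :* r) := x :* (y :* (p :* q) :* r)) refl
           (a C b) (b C c) (c !) ((b ∸ c) !) ((a ∸ b) !) ⟩
    (a C b) * ((b C c) * (c ! * (b ∸ c) !) * (a ∸ b) !)
      ≡⟨ cong (λ x → (a C b) * (x * (a ∸ b) !)) (nCk*[k!*[n∸k]!]≡n! c≤b) ⟩
    (a C b) * (b ! * (a ∸ b) !)
      ≡⟨ nCk*[k!*[n∸k]!]≡n! b≤a ⟩
    a !
      ≡⟨ nCk*[k!*[n∸k]!]≡n! (≤-trans c≤b b≤a) ⟨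
    (a C c) * (c ! * (a ∸ c) !)
      ≡⟨ cong (λ x → (a C c) * (c ! * x)) (nCk*[k!*[n∸k]!]≡n! (∸-monoˡ-≤ c b≤a)) ⟨
    (a C c) * (c ! * (((a ∸ c) C (b ∸ c)) * ((b ∸ c) ! * (a ∸ c ∸ (b ∸ c)) !)))
      ≡⟨ cong (λ x → (a C c) * (c ! * (((a ∸ c) C (b ∸ c)) * ((b ∸ c) ! * x !)))) a∸c∸[b∸c]≡a∸b ⟩
    (a C c) * (c ! * (((a ∸ c) C (b ∸ c)) * ((b ∸ c) ! * (a ∸ b) !)))
      ≡⟨ solve 5 (λ x y p q r → x :* (p :* (y :* (q :* r))) := x :* y :* (p :* q :* r)) refl
           (a C c) ((a ∸ c) C (b ∸ c)) (c !) ((b ∸ c) !) ((a ∸ b) !) ⟩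
    (a C c) * ((a ∸ c) C (b ∸ c)) * (c ! * (b ∸ c) ! * (a ∸ b) !) ∎)
  where
  open ≡-Reasoning
  open +-*-Solver
  instance
    _ = m*n≢0 (c ! * (b ∸ c) !) ((a ∸ b) !) {{c !* (b ∸ c) !≢0}} {{(a ∸ b) !≢0}}
  a∸c∸[b∸c]≡a∸b : a ∸ c ∸ (b ∸ c) ≡ a ∸ b
  a∸c∸[b∸c]≡a∸b = trans (∸-+-assoc a c (b ∸ c)) (cong (a ∸_) (m+[n∸m]≡n c≤b))

-- Binomial coefficients modulo 2

binomParity : ℕ → ℕ → Parity
binomParity n k = parity (n C k)

k>n⇒binomParity≡0 : ∀ {n k} → n < k → binomParity n k ≡ 0ℙ
k>n⇒binomParity≡0 n<k = cong parity (k>n⇒nCk≡0 n<k)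

binomParity≡1⇒k≤n : ∀ n k → binomParity n k ≡ 1ℙ → k ≤ n
binomParity≡1⇒k≤n n k odd with k ≤? n
... | yes k≤n = k≤n
... | no  k≰n with () ← trans (sym (k>n⇒binomParity≡0 (≰⇒> k≰n))) odd

-- By trinomial revision C(a, c) divides the odd number C(a, b) C(b, c). Oddness also yields the
-- bounds c ≤ b ≤ a that the revision asks for.
binomParity-trans : ∀ a b c → binomParity a b ≡ 1ℙ → binomParity b c ≡ 1ℙ →
                    binomParity a c ≡ 1ℙ
binomParity-trans a b c ab bc = p*q≡1⇒p≡1 (begin
  binomParity a c ℙ.* binomParity (a ∸ c) (b ∸ c)
    ≡⟨ ℙₚ.*-homo-* (a C c) _ ⟨
  parity ((a C c) * ((a ∸ c) C (b ∸ c)))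
    ≡⟨ cong parity (trinomial-revision (binomParity≡1⇒k≤n b c bc) (binomParity≡1⇒k≤n a b ab)) ⟨
  parity ((a C b) * (b C c))
    ≡⟨ ℙₚ.*-homo-* (a C b) _ ⟩
  binomParity a b ℙ.* binomParity b c
    ≡⟨ cong₂ ℙ._*_ ab bc ⟩
  1ℙ ∎)
  where
  open ≡-Reasoning
  p*q≡1⇒p≡1 : ∀ {p q} → p ℙ.* q ≡ 1ℙ → p ≡ 1ℙ
  p*q≡1⇒p≡1 {1ℙ} _ = refl

pascal : ∀ n k → binomParity (suc n) (suc k) ≡ binomParity n k ℙ.+ binomParity n (suc k)
pascal n k = trans (cong parity (sym (nCk+nC[k+1]≡[n+1]C[k+1] n k))) (ℙₚ.+-homo-+ (n C k) _)

-- This is (1 + x)² = 1 + x² over the field of two elements: the middle term `q` occurs twice and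
-- cancels.
pascal² : ∀ n k → binomParity (2 + n) (2 + k) ≡ binomParity n k ℙ.+ binomParity n (2 + k)
pascal² n k = begin
  binomParity (2 + n) (2 + k)
    ≡⟨ pascal (suc n) (suc k) ⟩
  binomParity (suc n) (suc k) ℙ.+ binomParity (suc n) (2 + k)
    ≡⟨ cong₂ ℙ._+_ (pascal n k) (pascal n (suc k)) ⟩
  (p ℙ.+ q) ℙ.+ (q ℙ.+ r)
    ≡⟨ ℙₚ.+-assoc p q (q ℙ.+ r) ⟩
  p ℙ.+ (q ℙ.+ (q ℙ.+ r))
    ≡⟨ cong (p ℙ.+_) (ℙₚ.+-assoc q q r) ⟨
  p ℙ.+ ((q ℙ.+ q) ℙ.+ r)
    ≡⟨ cong (λ x → p ℙ.+ (x ℙ.+ r)) (ℙₚ.p+p≡0ℙ q) ⟩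
  p ℙ.+ r ∎
  where
  open ≡-Reasoning
  p = binomParity n k
  q = binomParity n (suc k)
  r = binomParity n (2 + k)

-- Rows with only odd entries

-- Modulo 2, (1 + x)^(2n+1) = (1 + x)(1 + x²)^n, so columns 2j and 2j + 1 both carry C(n, j).
-- `pascal²` gives the induction on n.
binomParity-odd : ∀ n k → binomParity (suc (n + n)) k ≡ binomParity n ⌊ k /2⌋
binomParity-odd zero    0             = refl
binomParity-odd zero    1             = refl
binomParity-odd zero    (suc (suc k)) = refl
binomParity-odd (suc n) k rewrite +-suc n n = step k
  where
  step : ∀ k → binomParity (2 + suc (n + n)) k ≡ binomParity (suc n) ⌊ k /2⌋
  step 0 = refl
  -- `pascal²` starts at column 2. In column 1 the entry is the row number, and `parity` discards
  -- the added 2 by computation.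
  step 1 = begin
    binomParity (2 + suc (n + n)) 1 ≡⟨ cong parity (nC1≡n (2 + suc (n + n))) ⟩
    parity (suc (n + n))            ≡⟨ cong parity (nC1≡n (suc (n + n))) ⟨
    binomParity (suc (n + n)) 1     ≡⟨ binomParity-odd n 1 ⟩
    1ℙ                              ∎
    where open ≡-Reasoning
  step (suc (suc k)) = begin
    binomParity (2 + suc (n + n)) (2 + k)
      ≡⟨ pascal² (suc (n + n)) k ⟩
    binomParity (suc (n + n)) k ℙ.+ binomParity (suc (n + n)) (2 + k)
      ≡⟨ cong₂ ℙ._+_ (binomParity-odd n k) (binomParity-odd n (2 + k)) ⟩
    binomParity n ⌊ k /2⌋ ℙ.+ binomParity n (suc ⌊ k /2⌋)
      ≡⟨ pascal n ⌊ k /2⌋ ⟨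
    binomParity (suc n) (suc ⌊ k /2⌋) ∎
    where open ≡-Reasoning

OddRow : ℕ → Set
OddRow M = ∀ {k} → k ≤ M → binomParity M k ≡ 1ℙ

oddRow-double : ∀ {M} → OddRow M → OddRow (suc (M + M))
oddRow-double {M} odd {k} k≤1+M+M = trans (binomParity-odd M k)
  -- `⌈ M + M /2⌉` unfolds to `⌊ suc (M + M) /2⌋`, the bound obtained by halving k ≤ 2M + 1.
  (odd (subst (⌊ k /2⌋ ≤_) (sym (n≡⌈n+n/2⌉ M)) (⌊n/2⌋-mono k≤1+M+M)))

suc-pred-2^ : ∀ n → suc (pred (2 ^ n)) ≡ 2 ^ n
suc-pred-2^ n = suc-pred (2 ^ n) {{m^n≢0 2 n}}

-- Row 0 is odd, and M ↦ 2M + 1 takes 2^n - 1 to 2^(n+1) - 1.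
oddRow-pred-2^ : ∀ n → OddRow (pred (2 ^ n))
oddRow-pred-2^ zero    z≤n = refl
oddRow-pred-2^ (suc n) = subst OddRow 1+M+M≡ (oddRow-double (oddRow-pred-2^ n))
  where
  M = pred (2 ^ n)
  1+M+M≡ : suc (M + M) ≡ pred (2 ^ suc n)
  1+M+M≡ = begin
    suc (M + M)                 ≡⟨ +-suc M M ⟨
    pred (suc M + suc M)        ≡⟨ cong (λ x → pred (suc M + x)) (+-identityʳ (suc M)) ⟨
    pred (2 * suc M)            ≡⟨ cong (λ x → pred (2 * x)) (suc-pred-2^ n) ⟩
    pred (2 ^ suc n)            ∎
    where open ≡-Reasoning

-- Reflection of Pascal's triangle

-- Modulo 2 this is upper negation, C(-(b + 1), k) = (-1)^k C(b + k, k).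
upper-negation : ∀ {M} → OddRow M → ∀ b {c} k → b + c ≡ M → k ≤ c →
                 binomParity c k ≡ binomParity (b + k) k
upper-negation odd zero k refl k≤c =
  trans (odd k≤c) (sym (cong parity (nCn≡1 k)))
upper-negation odd (suc b) zero    eq k≤c = refl
upper-negation odd (suc b) {c} (suc k) eq 1+k≤c = begin
  binomParity c (suc k)
    ≡⟨ p≡q+r⇒r≡p+q (pascal c k) ⟩
  binomParity (suc c) (suc k) ℙ.+ binomParity c k
    -- The first call lowers b and raises c, keeping their sum M; the second keeps b and lowers k.
    ≡⟨ cong₂ ℙ._+_ (upper-negation odd b (suc k) (trans (+-suc b c) eq) (m≤n⇒m≤1+n 1+k≤c))
                   (upper-negation odd (suc b) k eq (<⇒≤ 1+k≤c)) ⟩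
  binomParity (b + suc k) (suc k) ℙ.+ binomParity (suc b + k) k
    ≡⟨ cong (λ x → binomParity (b + suc k) (suc k) ℙ.+ binomParity x k) (+-suc b k) ⟨
  binomParity (b + suc k) (suc k) ℙ.+ binomParity (b + suc k) k
    ≡⟨ ℙₚ.+-comm (binomParity (b + suc k) (suc k)) _ ⟩
  binomParity (b + suc k) k ℙ.+ binomParity (b + suc k) (suc k)
    ≡⟨ pascal (b + suc k) k ⟨
  binomParity (suc b + suc k) (suc k) ∎
  where
  open ≡-Reasoning
  p≡q+r⇒r≡p+q : ∀ {p q r} → p ≡ q ℙ.+ r → r ≡ p ℙ.+ q
  p≡q+r⇒r≡p+q {_} {q} {r} refl = sym (begin
    (q ℙ.+ r) ℙ.+ q ≡⟨ cong (ℙ._+ q) (ℙₚ.+-comm q r) ⟩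
    (r ℙ.+ q) ℙ.+ q ≡⟨ ℙₚ.+-assoc r q q ⟩
    r ℙ.+ (q ℙ.+ q) ≡⟨ cong (r ℙ.+_) (ℙₚ.p+p≡0ℙ q) ⟩
    r ℙ.+ 0ℙ        ≡⟨ ℙₚ.+-identityʳ r ⟩
    r               ∎)

[m+n]Cm≡[m+n]Cn : ∀ m n → (m + n) C m ≡ (m + n) C n
[m+n]Cm≡[m+n]Cn m n =
  trans (nCk≡nC[n∸k] (m≤m+n m n)) (cong ((m + n) C_) (m+n∸m≡n m n))

-- For b ≤ a put k = a - b. Row symmetry replaces column M - a of row M - b by column k, upper
-- negation moves to row b + k = a, and symmetry again gives column b. Otherwise both entries lie
-- above the diagonal.
binomParity-reflect : ∀ {M a b} → OddRow M → a ≤ M → b ≤ M →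
                      binomParity (M ∸ b) (M ∸ a) ≡ binomParity a b
binomParity-reflect {M} {a} {b} odd a≤M b≤M with b ≤? a
... | no b≰a = trans (k>n⇒binomParity≡0 (∸-monoʳ-< (≰⇒> b≰a) b≤M))
                     (sym (k>n⇒binomParity≡0 (≰⇒> b≰a)))
... | yes b≤a = begin
  binomParity (M ∸ b) (M ∸ a)             ≡⟨ cong (λ x → binomParity x (M ∸ a)) M∸b≡ ⟩
  binomParity (M ∸ a + k) (M ∸ a)         ≡⟨ cong parity ([m+n]Cm≡[m+n]Cn (M ∸ a) k) ⟩
  binomParity (M ∸ a + k) k               ≡⟨ cong (λ x → binomParity x k) M∸b≡ ⟨
  binomParity (M ∸ b) k                   ≡⟨ upper-negation odd b k (m+[n∸m]≡n b≤M) (∸-monoˡ-≤ b a≤M) ⟩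
  binomParity (b + k) k                   ≡⟨ cong parity ([m+n]Cm≡[m+n]Cn b k) ⟨
  binomParity (b + k) b                   ≡⟨ cong (λ x → binomParity x b) (m+[n∸m]≡n b≤a) ⟩
  binomParity a b                         ∎
  where
  open ≡-Reasoning
  k = a ∸ b
  M∸b≡ : M ∸ b ≡ M ∸ a + k
  M∸b≡ = begin
    M ∸ b           ≡⟨ cong (_∸ b) (m∸n+n≡m a≤M) ⟨
    M ∸ a + a ∸ b   ≡⟨ +-∸-assoc (M ∸ a) b≤a ⟩
    M ∸ a + k       ∎

-- Poset matrices

toBit : Parity → ℕ
toBit 0ℙ = 0
toBit 1ℙ = 1

n%2≡toBit : ∀ n → n % 2 ≡ toBit (parity n)
n%2≡toBit 0             = refl
n%2≡toBit 1             = refl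
n%2≡toBit (suc (suc n)) = n%2≡toBit n

n%2≡1⇒odd : ∀ n → n % 2 ≡ 1 → parity n ≡ 1ℙ
n%2≡1⇒odd 1             _  = refl
n%2≡1⇒odd (suc (suc n)) eq = n%2≡1⇒odd n eq

binaryPascal-isPosetMatrix : ∀ m → IsPosetMatrix (binaryPascal m)
binaryPascal-isPosetMatrix m = record
  { binary          = λ i j → n%2≡0∨1 (toℕ i C toℕ j)
  ; lowerTriangular = λ i j i<j → cong (_% 2) (k>n⇒nCk≡0 i<j)
  ; unitDiagonal    = λ i → cong (_% 2) (nCn≡1 (toℕ i))
  ; transitive      = λ i j k ij jk → trans (n%2≡toBit (toℕ i C toℕ k)) (cong toBit
      (binomParity-trans (toℕ i) (toℕ j) (toℕ k)
        (n%2≡1⇒odd (toℕ i C toℕ j) ij) (n%2≡1⇒odd (toℕ j C toℕ k) jk)))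
  }
  where
  n%2≡0∨1 : ∀ n → n % 2 ≡ 0 ⊎ n % 2 ≡ 1
  n%2≡0∨1 0             = inj₁ refl
  n%2≡0∨1 1             = inj₂ refl
  n%2≡0∨1 (suc (suc n)) = n%2≡0∨1 n

-- Each law is inherited at the indices `α i`; monotonicity of α keeps the zeros above the diagonal.
submatrix-isPosetMatrix : {A : Matrix m} {α : Vector (Fin m) n} →
                          IsQ α → IsPosetMatrix A → IsPosetMatrix (A ⟦ α ⟧)
submatrix-isPosetMatrix {α = α} α-mono poset = record
  { binary          = λ i j → binary (α i) (α j)
  ; lowerTriangular = λ i j i<j → lowerTriangular (α i) (α j) (α-mono i<j)
  ; unitDiagonal    = λ i → unitDiagonal (α i)
  ; transitive      = λ i j k → transitive (α i) (α j) (α k)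
  }
  where open IsPosetMatrix poset

-- Matrices are functions and `≋` is pointwise, so the laws are transported entry by entry.
isPosetMatrix-resp-≋ : {A B : Matrix n} → A ≋ B → IsPosetMatrix B → IsPosetMatrix A
isPosetMatrix-resp-≋ A≋B poset = record
  { binary          = λ i j → subst (λ x → x ≡ 0 ⊎ x ≡ 1) (sym (A≋B i j)) (binary i j)
  ; lowerTriangular = λ i j i<j → trans (A≋B i j) (lowerTriangular i j i<j)
  ; unitDiagonal    = λ i → trans (A≋B i i) (unitDiagonal i)
  ; transitive      = λ i j k ij jk → trans (A≋B i k)
      (transitive i j k (trans (sym (A≋B i j)) ij) (trans (sym (A≋B j k)) jk))
  }
  where open IsPosetMatrix poset

-- Complementation and the dual matrix

opposite-anti-mono-< : {i j : Fin n} → i Fin.< j → opposite j Fin.< opposite i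
opposite-anti-mono-< {n} {i} {j} i<j
  rewrite opposite-prop i | opposite-prop j = ∸-monoʳ-< (s<s i<j) (toℕ<n j)

-- Reversing positions and complementing entries each reverse the order, so together they preserve
-- it.
reverseComplement-isQ : {α : Vector (Fin m) n} → IsQ α → IsQ (reverseComplement α)
reverseComplement-isQ α-mono i<j =
  opposite-anti-mono-< (α-mono (opposite-anti-mono-< i<j))

binaryPascal-opposite : ∀ n (i j : Fin (2 ^ n)) →
  binaryPascal (2 ^ n) (opposite j) (opposite i) ≡ binaryPascal (2 ^ n) i j
binaryPascal-opposite n i j = begin
  (toℕ (opposite j) C toℕ (opposite i)) % 2
    ≡⟨ cong₂ (λ x y → (x C y) % 2) (toℕ-opposite j) (toℕ-opposite i) ⟩
  ((M ∸ toℕ j) C (M ∸ toℕ i)) % 2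
    ≡⟨ n%2≡toBit ((M ∸ toℕ j) C (M ∸ toℕ i)) ⟩
  toBit (binomParity (M ∸ toℕ j) (M ∸ toℕ i))
    ≡⟨ cong toBit (binomParity-reflect (oddRow-pred-2^ n) (toℕ≤M i) (toℕ≤M j)) ⟩
  toBit (binomParity (toℕ i) (toℕ j))
    ≡⟨ n%2≡toBit (toℕ i C toℕ j) ⟨
  (toℕ i C toℕ j) % 2 ∎
  where
  open ≡-Reasoning
  M = pred (2 ^ n)
  toℕ≤M : (k : Fin (2 ^ n)) → toℕ k ≤ M
  toℕ≤M k = <⇒≤pred (toℕ<n k)
  toℕ-opposite : (k : Fin (2 ^ n)) → toℕ (opposite k) ≡ M ∸ toℕ k
  -- `opposite-prop` gives `2 ^ n ∸ suc (toℕ k)`; with `2 ^ n` written as `suc M` the two successors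
  -- cancel by computation.
  toℕ-opposite k = trans (opposite-prop k) (cong (_∸ suc (toℕ k)) (sym (suc-pred-2^ n)))

theorem5p1 : ∀ (n : ℕ) (α : Vector (Fin (2 ^ n)) n) → IsQ α →
    let A = binaryPascal (2 ^ n) ⟦ α ⟧
        β = reverseComplement α
    in IsQ β × IsPosetMatrix (dual A) × dual A ≋ binaryPascal (2 ^ n) ⟦ β ⟧
theorem5p1 n α α-mono =
  -- The poset laws of the dual are read off from P[β].
  β-mono , isPosetMatrix-resp-≋ A*≋P[β] (submatrix-isPosetMatrix β-mono
    (binaryPascal-isPosetMatrix (2 ^ n))) , A*≋P[β]
  where
  β-mono : IsQ (reverseComplement α)
  β-mono = reverseComplement-isQ α-mono
  A*≋P[β] : dual (binaryPascal (2 ^ n) ⟦ α ⟧) ≋ binaryPascal (2 ^ n) ⟦ reverseComplement α ⟧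
  -- Flip transposition supplies the swap of row and column that the reflection undoes.
  A*≋P[β] i j = trans (dual-entry (binaryPascal (2 ^ n) ⟦ α ⟧) i j)
    (sym (binaryPascal-opposite n (α (opposite j)) (α (opposite i))))
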